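{- Let $n$ be a positive integer and let $G$ be the finite cyclic group of order $n$. Then the reduced power graph $R(G)$ is isomorphic to the divisor graph $D(n)$.
   Context: All graphs are finite, simple and undirected. The power graph $Pow(G)$ of a group $G$ is the graph with vertex set $G$ in which two distinct vertices $x,y$ are adjacent if $x=y^m$ or $y=x^m$ for some positive integer $m$. Define an equivalence relation on $G$ by $x\sim y$ if and only if $\langle x\rangle=\langle y\rangle$, and write $[x]$ for the class of $x$. The reduced power graph $R(G)$ has as vertices the equivalence classes of $\sim$; two distinct classes $[x],[y]$ are adjacent if and only if $\{x,y\}$ is an edge of $Pow(G)$ (this does not depend on the choice of representatives). The divisor graph $D(n)$ has as vertex set the set of positive divisors of $n$; two distinct vertices $a,b$ are adjacent if and only if $a\mid b$ or $b\mid a$. -}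

module Defs where

open import Level using (Level; _⊔_) renaming (suc to lsuc)
open import Algebra.Bundles using (Group)
import Algebra.Properties.Group as GroupProperties
import Algebra.Properties.Monoid.Mult as Mult
open import Data.Empty using (⊥-elim)
open import Data.Fin using (Fin; toℕ; fromℕ<)
open import Data.Fin.Properties using (pigeonhole; toℕ-fromℕ<)
open import Data.Integer using (ℤ; +_; -[1+_])
open import Data.Nat using (ℕ; zero; suc; _+_; _*_; _∸_; _<_; NonZero; z<s)
open import Data.Nat.Divisibility using (_∣_; _∣?_; 1∣_; ∣⇒≤)
open import Data.Nat.Properties
  using (n<1+n; m+[n∸m]≡n; <⇒≤; m<n⇒0<n∸m; *-mono-<; ≤-trans; m≤n+m; +-comm; *-suc)
open import Data.Product using (∃; _×_; _,_; proj₁; proj₂)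
open import Data.Sum using (_⊎_; inj₁; inj₂; swap)
open import Function.Base using (_∘_)
open import Function.Bundles using (Bijection; Surjection; Inverse; _⇔_)
open import Relation.Binary.Bundles using (Setoid)
open import Relation.Binary.Core using (Rel)
open import Relation.Binary.Definitions using (Symmetric; Irreflexive; _Respects₂_)
open import Relation.Binary.PropositionalEquality as ≡ using (_≡_; _≢_)
open import Relation.Nullary using (¬_; yes; no)
open import Relation.Unary using (Pred; _≐_)
open import Relation.Unary.Properties using (≐-refl; ≐-sym; ≐-trans)

-- A finite, simple, undirected graph.  Vertices are compared by the equality
-- of a setoid, so that a graph on equivalence classes is a graph on
-- representatives whose adjacency does not depend on their choice.  The
-- enumeration witnessing finiteness may repeat vertices.
record Graph (v e a : Level) : Set (lsuc (v ⊔ e ⊔ a)) where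
  field
    vertices : Setoid v e
  open Setoid vertices public using () renaming (Carrier to Vertex; _≈_ to _≈ᵥ_)
  field
    Adj        : Rel Vertex a
    adj-resp   : Adj Respects₂ _≈ᵥ_
    adj-sym    : Symmetric Adj
    adj-irrefl : Irreflexive _≈ᵥ_ Adj
    finite     : ∃ λ k → Surjection (≡.setoid (Fin k)) vertices

record _≅_ {v e a v′ e′ a′ : Level} (Γ : Graph v e a) (Δ : Graph v′ e′ a′) :
           Set (v ⊔ e ⊔ a ⊔ v′ ⊔ e′ ⊔ a′) where
  private
    module Γ = Graph Γ
    module Δ = Graph Δ
  field
    vertexInverse : Inverse Γ.vertices Δ.vertices
  open Inverse vertexInverse using (to)
  field
    adj⇔ : ∀ x y → Γ.Adj x y ⇔ Δ.Adj (to x) (to y)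

infix 4 _≅_

record FiniteGroup (c ℓ : Level) : Set (lsuc (c ⊔ ℓ)) where
  field
    group       : Group c ℓ
    order       : ℕ
    enumeration : Bijection (≡.setoid (Fin order)) (Group.setoid group)

module _ {c ℓ : Level} (G : Group c ℓ) where
  open Group G
  open Mult monoid using () renaming (_×_ to _times_)

  infixr 8 _^_ _^ℤ_

  _^_ : Carrier → ℕ → Carrier
  x ^ m = m times x

  _^ℤ_ : Carrier → ℤ → Carrier
  x ^ℤ (+ m)    = x ^ m
  x ^ℤ -[1+ m ] = (x ^ suc m) ⁻¹

  ⟨_⟩ : Carrier → Pred Carrier ℓ
  ⟨ x ⟩ y = ∃ λ k → y ≈ x ^ℤ k

  IsCyclic : Set (c ⊔ ℓ)
  IsCyclic = ∃ λ g → ∀ x → ⟨ g ⟩ x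

  infix 4 _∼_

  _∼_ : Rel Carrier (c ⊔ ℓ)
  x ∼ y = ⟨ x ⟩ ≐ ⟨ y ⟩

  PositivePowerOf : Rel Carrier ℓ
  PositivePowerOf x y = ∃ λ m → 0 < m × x ≈ y ^ m

  PowAdj : Rel Carrier ℓ
  PowAdj x y = ¬ x ≈ y × (PositivePowerOf x y ⊎ PositivePowerOf y x)

  ∼-setoid : Setoid c (c ⊔ ℓ)
  ∼-setoid = record
    { Carrier = Carrier
    ; _≈_     = _∼_
    ; isEquivalence = record { refl = ≐-refl ; sym = ≐-sym ; trans = ≐-trans }
    }

  ^ℤ-cong : ∀ {x y} k → x ≈ y → x ^ℤ k ≈ y ^ℤ k
  ^ℤ-cong (+ m)    x≈y = Mult.×-congʳ monoid m x≈y
  ^ℤ-cong -[1+ m ] x≈y = ⁻¹-cong (Mult.×-congʳ monoid (suc m) x≈y)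

  ≈⇒∼ : ∀ {x y} → x ≈ y → x ∼ y
  ≈⇒∼ x≈y = (λ (k , p) → k , trans p (^ℤ-cong k x≈y))
          , (λ (k , p) → k , trans p (^ℤ-cong k (sym x≈y)))

  ∼⇒∈ : ∀ {x y} → x ∼ y → ⟨ y ⟩ x
  ∼⇒∈ {x} x∼y = proj₁ x∼y (+ 1 , sym (identityʳ x))

  positivePowerOf-trans : ∀ {x y z} → PositivePowerOf x y → PositivePowerOf y z →
                          PositivePowerOf x z
  positivePowerOf-trans {x} {y} {z} (m , 0<m , x≈yᵐ) (l , 0<l , y≈zˡ) =
    m * l , *-mono-< 0<m 0<l ,
    trans x≈yᵐ (trans (Mult.×-congʳ monoid m y≈zˡ) (Mult.×-assocˡ monoid z m l))

  powAdj-sym : Symmetric PowAdj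
  powAdj-sym (x≉y , p) = (x≉y ∘ sym) , swap p

  powAdj-resp : PowAdj Respects₂ _≈_
  powAdj-resp = respʳ , λ x≈x′ → powAdj-sym ∘ respʳ x≈x′ ∘ powAdj-sym
    where
    respʳ : ∀ {x y y′} → y ≈ y′ → PowAdj x y → PowAdj x y′
    respʳ y≈y′ (x≉y , inj₁ (m , 0<m , p)) =
      (λ q → x≉y (trans q (sym y≈y′))) ,
      inj₁ (m , 0<m , trans p (Mult.×-congʳ monoid m y≈y′))
    respʳ y≈y′ (x≉y , inj₂ (m , 0<m , p)) =
      (λ q → x≉y (trans q (sym y≈y′))) ,
      inj₂ (m , 0<m , trans (sym y≈y′) p)

module _ {c ℓ : Level} (𝔾 : FiniteGroup c ℓ) where
  open FiniteGroup 𝔾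
  open Group group
  open Bijection enumeration using (to; to⁻; surjection; surjective)
  open GroupProperties group using (identityʳ-unique; inverseˡ-unique)
  open Mult monoid using (×-congʳ; ×-congˡ; ×-homo-+; ×-assocˡ)

  private
    infixr 8 _^ᴳ_
    _^ᴳ_ : Carrier → ℕ → Carrier
    _^ᴳ_ = _^_ group

  powerGraph : Graph c ℓ ℓ
  powerGraph = record
    { vertices   = setoid
    ; Adj        = PowAdj group
    ; adj-resp   = powAdj-resp group
    ; adj-sym    = powAdj-sym group
    ; adj-irrefl = λ x≈y (x≉y , _) → x≉y x≈y
    ; finite     = order , surjection
    }

  exponent : ∀ x → ∃ λ d → 0 < d × x ^ᴳ d ≈ ε
  exponent x
    with i , j , i<j , eq ← pigeonhole (n<1+n order) (λ i → to⁻ (x ^ᴳ toℕ i)) =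
    toℕ j ∸ toℕ i , m<n⇒0<n∸m i<j , identityʳ-unique _ _ xⁱxʲ⁻ⁱ≈xⁱ
    where
    to∘to⁻ : ∀ y → to (to⁻ y) ≈ y
    to∘to⁻ y = proj₂ (surjective y) ≡.refl
    xʲ≈xⁱ : x ^ᴳ toℕ j ≈ x ^ᴳ toℕ i
    xʲ≈xⁱ = trans (sym (to∘to⁻ _))
              (trans (reflexive (≡.cong to (≡.sym eq))) (to∘to⁻ _))
    xⁱxʲ⁻ⁱ≈xⁱ : x ^ᴳ toℕ i ∙ x ^ᴳ (toℕ j ∸ toℕ i) ≈ x ^ᴳ toℕ i
    xⁱxʲ⁻ⁱ≈xⁱ = trans (sym (×-homo-+ x (toℕ i) _))
                  (trans (×-congˡ (m+[n∸m]≡n (<⇒≤ i<j))) xʲ≈xⁱ)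

  -- This is where finiteness is needed: in an infinite cyclic group the
  -- inverse of a generator is not a positive power of it.
  ∈⇒positivePowerOf : ∀ {x y} → ⟨_⟩ group x y → PositivePowerOf group y x
  ∈⇒positivePowerOf {x} {y} (k , y≈xᵏ) with exponent x
  ... | d@(suc e) , 0<d , xᵈ≈ε = fromℤ k y≈xᵏ
    where
    ^ε : ∀ m → ε ^ᴳ m ≈ ε
    ^ε zero    = refl
    ^ε (suc m) = trans (identityˡ _) (^ε m)

    fromℕ : ∀ m → y ≈ x ^ᴳ m → PositivePowerOf group y x
    fromℕ m p = m + d , ≤-trans 0<d (m≤n+m d m) ,
      trans p (sym (trans (×-homo-+ x m d) (trans (∙-congˡ xᵈ≈ε) (identityʳ _))))

    x⁻ᵐ : ∀ m → x ^ᴳ (m * e) ≈ (x ^ᴳ m) ⁻¹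
    x⁻ᵐ m = inverseˡ-unique _ _ eq
      where
      eq : x ^ᴳ (m * e) ∙ x ^ᴳ m ≈ ε
      eq = trans (sym (×-homo-+ x (m * e) m))
             (trans (×-congˡ (≡.trans (+-comm (m * e) m) (≡.sym (*-suc m e))))
               (trans (sym (×-assocˡ x m d)) (trans (×-congʳ m xᵈ≈ε) (^ε m))))

    fromℤ : ∀ k → y ≈ _^ℤ_ group x k → PositivePowerOf group y x
    fromℤ (+ m)    p = fromℕ m p
    fromℤ -[1+ m ] p = fromℕ (suc m * e) (trans p (sym (x⁻ᵐ (suc m))))

  -- The class [ x ] is represented by x, with classes compared by _∼_.
  ReducedAdj : Rel Carrier (c ⊔ ℓ)
  ReducedAdj x y = ¬ _∼_ group x y × Graph.Adj powerGraph x y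

  reducedAdj-sym : Symmetric ReducedAdj
  reducedAdj-sym (x≁y , p) = (x≁y ∘ ≐-sym) , powAdj-sym group p

  reducedAdj-resp : ReducedAdj Respects₂ _∼_ group
  reducedAdj-resp = respʳ , λ x∼x′ → reducedAdj-sym ∘ respʳ x∼x′ ∘ reducedAdj-sym
    where
    respʳ : ∀ {x y y′} → _∼_ group y y′ → ReducedAdj x y → ReducedAdj x y′
    respʳ {x} {y} {y′} y∼y′ (x≁y , _ , p) = x≁y′ , (x≁y′ ∘ ≈⇒∼ group) , powers p
      where
      x≁y′ : ¬ _∼_ group x y′
      x≁y′ x∼y′ = x≁y (≐-trans x∼y′ (≐-sym y∼y′))
      powers : PositivePowerOf group x y ⊎ PositivePowerOf group y x →
               PositivePowerOf group x y′ ⊎ PositivePowerOf group y′ x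
      powers (inj₁ q) = inj₁ (positivePowerOf-trans group q
                                (∈⇒positivePowerOf (∼⇒∈ group y∼y′)))
      powers (inj₂ q) = inj₂ (positivePowerOf-trans group
                                (∈⇒positivePowerOf (∼⇒∈ group (≐-sym y∼y′))) q)

  reducedPowerGraph : Graph c (c ⊔ ℓ) (c ⊔ ℓ)
  reducedPowerGraph = record
    { vertices   = ∼-setoid group
    ; Adj        = ReducedAdj
    ; adj-resp   = reducedAdj-resp
    ; adj-sym    = reducedAdj-sym
    ; adj-irrefl = λ x∼y (x≁y , _) → x≁y x∼y
    ; finite     = order , record
        { to         = to
        ; cong       = ≈⇒∼ group ∘ reflexive ∘ ≡.cong to
        ; surjective = λ y → proj₁ (surjective y) , ≈⇒∼ group ∘ proj₂ (surjective y)
        }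
    }

record Divisor (n : ℕ) : Set where
  constructor divisor
  field
    value    : ℕ
    positive : 0 < value
    divides  : value ∣ n

open Divisor public using (value)

-- Divisors are compared by value only, ignoring the proofs they carry.
divisorSetoid : ℕ → Setoid _ _
divisorSetoid n = record
  { Carrier = Divisor n
  ; _≈_     = λ a b → value a ≡ value b
  ; isEquivalence = record { refl = ≡.refl ; sym = ≡.sym ; trans = ≡.trans }
  }

DivisorAdj : ∀ {n} → Rel (Divisor n) _
DivisorAdj a b = value a ≢ value b × (value a ∣ value b ⊎ value b ∣ value a)

divisors-finite : ∀ n .{{_ : NonZero n}} →
                  ∃ λ k → Surjection (≡.setoid (Fin k)) (divisorSetoid n)
divisors-finite n = n , record
  { to         = enum
  ; cong       = λ { ≡.refl → ≡.refl }
  ; surjective = onto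
  }
  where
  enum : Fin n → Divisor n
  enum i with suc (toℕ i) ∣? n
  ... | yes d∣n = divisor (suc (toℕ i)) z<s d∣n
  ... | no  _   = divisor 1 z<s (1∣ n)

  enum-value : ∀ i → suc (toℕ i) ∣ n → value (enum i) ≡ suc (toℕ i)
  enum-value i d∣n with suc (toℕ i) ∣? n
  ... | yes _   = ≡.refl
  ... | no  d∤n = ⊥-elim (d∤n d∣n)

  onto : ∀ (b : Divisor n) → ∃ λ i → ∀ {j} → j ≡ i → value (enum j) ≡ value b
  onto (divisor (suc m) _ d∣n) = i , λ { ≡.refl → ≡.trans (enum-value i i∣n) (≡.cong suc eq) }
    where
    m<n : m < n
    m<n = ∣⇒≤ d∣n
    i : Fin n
    i = fromℕ< m<n
    eq : toℕ i ≡ m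
    eq = toℕ-fromℕ< m<n
    i∣n : suc (toℕ i) ∣ n
    i∣n = ≡.subst (λ l → suc l ∣ n) (≡.sym eq) d∣n

divisorGraph : ∀ n .{{_ : NonZero n}} → Graph _ _ _
divisorGraph n = record
  { vertices   = divisorSetoid n
  ; Adj        = DivisorAdj
  ; adj-resp   = (λ { ≡.refl p → p }) , (λ { ≡.refl p → p })
  ; adj-sym    = λ (a≢b , p) → (a≢b ∘ ≡.sym) , swap p
  ; adj-irrefl = λ a≡b (a≢b , _) → a≢b a≡b
  ; finite     = divisors-finite n
  }

{-# OPTIONS --safe #-}

-- Let g generate G and send x = gᵏ to gcd(k, n).  Since g has order exactly n,
-- any c ∣ n divides all the exponents k with x = gᵏ or none of them, so this is
-- well defined.  By Bézout, y is a power of x iff gcd(k, n) divides the divisor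
-- of y; hence classes correspond to divisors and adjacency to divisibility.
module Submission where

open import Defs
open import Level using (Level)
open import Algebra.Bundles using (Group)
import Algebra.Properties.Group as GroupProperties
import Algebra.Properties.Monoid.Mult as Mult
open import Data.Fin using (Fin; toℕ)
open import Data.Fin.Properties using (pigeonhole; injective⇒≤; toℕ<n; toℕ-fromℕ<)
open import Data.Integer using (+_)
open import Data.Nat
  using (ℕ; zero; suc; _+_; _*_; _∸_; _<_; _≤_; NonZero; pred; >-nonZero; ≢-nonZero⁻¹)
open import Data.Nat.Divisibility
  using (_∣_; divides; ∣-refl; ∣-reflexive; ∣-trans; ∣-antisym; n∣m*n; ∣n⇒∣m*n;
         ∣m+n∣m⇒∣n; m%n≡0⇒n∣m)
open import Data.Nat.DivMod using (_%_; _/_; _mod_; m≡m%n+[m/n]*n; m%n<n)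
open import Data.Nat.GCD
  using (gcd; gcd[m,n]∣m; gcd[m,n]∣n; gcd-greatest; gcd[m,n]≢0; gcd-GCD; module Bézout)
open import Data.Nat.Properties
  using (n<1+n; m+[n∸m]≡n; <⇒≤; <⇒≱; m<n⇒0<n∸m; m∸n≤m; ≤-trans; ≤-antisym; ≤-pred; +-comm;
         *-comm; *-assoc; *-suc; suc-pred; n≢0⇒n>0; n≤0⇒n≡0; ≮⇒≥)
open import Data.Product using (∃; _,_; proj₁; proj₂)
open import Data.Sum as Sum using (inj₂)
open import Function.Base using (_∘_)
open import Function.Bundles using (Bijection; mk⇔)
open import Relation.Binary.PropositionalEquality as ≡ using (_≡_)
import Relation.Binary.Reasoning.Setoid as SetoidReasoning

module PowerProperties {c ℓ : Level} (G : Group c ℓ) where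
  open Group G
  open Mult monoid using (×-congʳ; ×-congˡ; ×-homo-+; ×-assocˡ)
  open SetoidReasoning setoid

  private
    infixr 8 _^ᴳ_
    _^ᴳ_ : Carrier → ℕ → Carrier
    _^ᴳ_ = _^_ G

  ε^m≈ε : ∀ m → ε ^ᴳ m ≈ ε
  ε^m≈ε zero    = refl
  ε^m≈ε (suc m) = trans (identityˡ _) (ε^m≈ε m)

  x^d≈ε∧d∣m⇒x^m≈ε : ∀ {x d m} → x ^ᴳ d ≈ ε → d ∣ m → x ^ᴳ m ≈ ε
  x^d≈ε∧d∣m⇒x^m≈ε {x} {d} {m} x^d≈ε (divides q m≡q*d) = begin
    x ^ᴳ m        ≈⟨ ×-congˡ m≡q*d ⟩
    x ^ᴳ (q * d)  ≈⟨ ×-assocˡ x q d ⟨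
    (x ^ᴳ d) ^ᴳ q ≈⟨ ×-congʳ q x^d≈ε ⟩
    ε ^ᴳ q        ≈⟨ ε^m≈ε q ⟩
    ε             ∎

  x^m≈x^[m%d] : ∀ {x} d .{{_ : NonZero d}} → x ^ᴳ d ≈ ε → ∀ m → x ^ᴳ m ≈ x ^ᴳ (m % d)
  x^m≈x^[m%d] {x} d x^d≈ε m = begin
    x ^ᴳ m                            ≈⟨ ×-congˡ (m≡m%n+[m/n]*n m d) ⟩
    x ^ᴳ (m % d + m / d * d)          ≈⟨ ×-homo-+ x (m % d) _ ⟩
    x ^ᴳ (m % d) ∙ x ^ᴳ (m / d * d)   ≈⟨ ∙-congˡ (x^d≈ε∧d∣m⇒x^m≈ε x^d≈ε (n∣m*n (m / d))) ⟩
    x ^ᴳ (m % d) ∙ ε                  ≈⟨ identityʳ _ ⟩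
    x ^ᴳ (m % d)                      ∎

module CyclicGroup {c ℓ : Level} (𝔾 : FiniteGroup c ℓ) .{{_ : NonZero (FiniteGroup.order 𝔾)}}
                   (cyclic : IsCyclic (FiniteGroup.group 𝔾)) where
  open FiniteGroup 𝔾 renaming (order to n)
  open Group group
  open GroupProperties group using (identityʳ-unique)
  open Mult monoid using (×-congʳ; ×-congˡ; ×-homo-+; ×-assocˡ)
  open Bijection enumeration using (to; to⁻; injective; surjective)
  open PowerProperties group
  open SetoidReasoning setoid

  infixr 8 _^ᴳ_
  _^ᴳ_ : Carrier → ℕ → Carrier
  _^ᴳ_ = _^_ group

  g : Carrier
  g = proj₁ cyclic

  -- The exponent is a natural number so that `gcd` and `_%_` apply to it. It need not be least, nor
  -- the same for `_≈_`-equal elements; only its common divisors with `n` will matter.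
  log : Carrier → ℕ
  log x = proj₁ (∈⇒positivePowerOf 𝔾 (proj₂ cyclic x))

  g^log : ∀ x → x ≈ g ^ᴳ log x
  g^log x = proj₂ (proj₂ (∈⇒positivePowerOf 𝔾 (proj₂ cyclic x)))

  -- When `g ^ᴳ d ≈ ε`, exponents can be reduced modulo `d` without changing the element, so the `n`
  -- elements embed into `d` residues.
  g^d≈ε⇒n≤d : ∀ {d} → 0 < d → g ^ᴳ d ≈ ε → n ≤ d
  g^d≈ε⇒n≤d {d} 0<d g^d≈ε = injective⇒≤ {f = residue} residue-injective
    where
    instance
      d≢0 : NonZero d
      d≢0 = >-nonZero 0<d

    residue : Fin n → Fin d
    residue i = log (to i) mod d

    g^residue : ∀ i → to i ≈ g ^ᴳ toℕ (residue i)
    g^residue i = begin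
      to i                     ≈⟨ g^log (to i) ⟩
      g ^ᴳ log (to i)          ≈⟨ x^m≈x^[m%d] d g^d≈ε (log (to i)) ⟩
      g ^ᴳ (log (to i) % d)    ≈⟨ ×-congˡ (toℕ-fromℕ< (m%n<n (log (to i)) d)) ⟨
      g ^ᴳ toℕ (residue i)     ∎

    residue-injective : ∀ {i j} → residue i ≡ residue j → i ≡ j
    residue-injective {i} {j} eq = injective (begin
      to i                  ≈⟨ g^residue i ⟩
      g ^ᴳ toℕ (residue i)  ≈⟨ ×-congˡ (≡.cong toℕ eq) ⟩
      g ^ᴳ toℕ (residue j)  ≈⟨ g^residue j ⟨
      to j                  ∎)

  -- Two of the `n + 1` powers with exponents from 0 to `n` coincide, so some positive exponent at
  -- most `n` kills `g`. By the preceding bound it is also at least `n`.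
  g^n≈ε : g ^ᴳ n ≈ ε
  g^n≈ε with i , j , i<j , eq ← pigeonhole (n<1+n n) (λ i → to⁻ (g ^ᴳ toℕ i)) =
    trans (×-congˡ (≤-antisym (g^d≈ε⇒n≤d (m<n⇒0<n∸m i<j) g^j∸i≈ε) j∸i≤n)) g^j∸i≈ε
    where
    to∘to⁻ : ∀ y → to (to⁻ y) ≈ y
    to∘to⁻ y = proj₂ (surjective y) ≡.refl

    g^j∸i≈ε : g ^ᴳ (toℕ j ∸ toℕ i) ≈ ε
    g^j∸i≈ε = identityʳ-unique _ _ (begin
      g ^ᴳ toℕ i ∙ g ^ᴳ (toℕ j ∸ toℕ i) ≈⟨ ×-homo-+ g (toℕ i) _ ⟨
      g ^ᴳ (toℕ i + (toℕ j ∸ toℕ i))    ≈⟨ ×-congˡ (m+[n∸m]≡n (<⇒≤ i<j)) ⟩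
      g ^ᴳ toℕ j                        ≈⟨ to∘to⁻ _ ⟨
      to (to⁻ (g ^ᴳ toℕ j))             ≡⟨ ≡.cong to eq ⟨
      to (to⁻ (g ^ᴳ toℕ i))             ≈⟨ to∘to⁻ _ ⟩
      g ^ᴳ toℕ i                        ∎)

    j∸i≤n : toℕ j ∸ toℕ i ≤ n
    j∸i≤n = ≤-trans (m∸n≤m (toℕ j) (toℕ i)) (≤-pred (toℕ<n j))

  -- The remainder `m % n` kills `g` as well but is below `n`, so it cannot be positive.
  g^m≈ε⇒n∣m : ∀ m → g ^ᴳ m ≈ ε → n ∣ m
  g^m≈ε⇒n∣m m g^m≈ε = m%n≡0⇒n∣m m n (n≤0⇒n≡0 (≮⇒≥ λ 0<m%n →
    <⇒≱ (m%n<n m n) (g^d≈ε⇒n≤d 0<m%n (trans (sym (x^m≈x^[m%d] n g^n≈ε m)) g^m≈ε))))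

  m+m*pred[n]≡m*n : ∀ m → m + m * pred n ≡ m * n
  m+m*pred[n]≡m*n m = ≡.trans (≡.sym (*-suc m (pred n))) (≡.cong (m *_) (suc-pred n))

  -- g^(m (n − 1)) is the inverse of g^m, written with a natural exponent.
  g^m∙g^m*pred[n]≈ε : ∀ m → g ^ᴳ m ∙ g ^ᴳ (m * pred n) ≈ ε
  g^m∙g^m*pred[n]≈ε m = begin
    g ^ᴳ m ∙ g ^ᴳ (m * pred n)  ≈⟨ ×-homo-+ g m _ ⟨
    g ^ᴳ (m + m * pred n)       ≈⟨ ×-congˡ (m+m*pred[n]≡m*n m) ⟩
    g ^ᴳ (m * n)                ≈⟨ x^d≈ε∧d∣m⇒x^m≈ε g^n≈ε (n∣m*n m) ⟩
    ε                           ∎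

  -- The exponents are congruent modulo `n`, stated without subtraction as `n ∣ i + j * pred n`.
  -- Hence `d` divides `j * pred n`, and also `j * n`, which exceeds it by `j`.
  ∣-exponent : ∀ {d} i j → d ∣ n → g ^ᴳ i ≈ g ^ᴳ j → d ∣ i → d ∣ j
  ∣-exponent {d} i j d∣n g^i≈g^j d∣i = ∣m+n∣m⇒∣n d∣j*pred[n]+j d∣j*pred[n]
    where
    n∣i+j*pred[n] : n ∣ i + j * pred n
    n∣i+j*pred[n] = g^m≈ε⇒n∣m _
      (trans (×-homo-+ g i _) (trans (∙-congʳ g^i≈g^j) (g^m∙g^m*pred[n]≈ε j)))

    d∣j*pred[n] : d ∣ j * pred n
    d∣j*pred[n] = ∣m+n∣m⇒∣n (∣-trans d∣n n∣i+j*pred[n]) d∣i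

    d∣j*pred[n]+j : d ∣ j * pred n + j
    d∣j*pred[n]+j = ≡.subst (d ∣_)
      (≡.trans (≡.sym (m+m*pred[n]≡m*n j)) (+-comm j _)) (∣n⇒∣m*n j d∣n)

  g^gcd-power : ∀ b → ∃ λ m → g ^ᴳ gcd b n ≈ g ^ᴳ (m * b)
  g^gcd-power b with Bézout.identity (gcd-GCD b n)
  ... | Bézout.+- x y eq = x , (begin
    g ^ᴳ gcd b n                  ≈⟨ identityʳ _ ⟨
    g ^ᴳ gcd b n ∙ ε              ≈⟨ ∙-congˡ (x^d≈ε∧d∣m⇒x^m≈ε g^n≈ε (n∣m*n y)) ⟨
    g ^ᴳ gcd b n ∙ g ^ᴳ (y * n)   ≈⟨ ×-homo-+ g (gcd b n) _ ⟨
    g ^ᴳ (gcd b n + y * n)        ≈⟨ ×-congˡ eq ⟩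
    g ^ᴳ (x * b)                  ∎)
  -- Here `gcd b n + x * b ≡ y * n`, so `g ^ᴳ gcd b n` is the inverse of `g ^ᴳ (x * b)`; the factor
  -- `pred n` expresses that inverse.
  ... | Bézout.-+ x y eq = pred n * x , (begin
    g ^ᴳ gcd b n                                               ≈⟨ identityʳ _ ⟨
    g ^ᴳ gcd b n ∙ ε                                           ≈⟨ ∙-congˡ (g^m∙g^m*pred[n]≈ε (x * b)) ⟨
    g ^ᴳ gcd b n ∙ (g ^ᴳ (x * b) ∙ g ^ᴳ (x * b * pred n))      ≈⟨ assoc _ _ _ ⟨
    (g ^ᴳ gcd b n ∙ g ^ᴳ (x * b)) ∙ g ^ᴳ (x * b * pred n)      ≈⟨ ∙-congʳ (×-homo-+ g (gcd b n) _) ⟨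
    g ^ᴳ (gcd b n + x * b) ∙ g ^ᴳ (x * b * pred n)             ≈⟨ ∙-congʳ (×-congˡ eq) ⟩
    g ^ᴳ (y * n) ∙ g ^ᴳ (x * b * pred n)                       ≈⟨ ∙-congʳ (x^d≈ε∧d∣m⇒x^m≈ε g^n≈ε (n∣m*n y)) ⟩
    ε ∙ g ^ᴳ (x * b * pred n)                                  ≈⟨ identityˡ _ ⟩
    g ^ᴳ (x * b * pred n)                                      ≈⟨ ×-congˡ (≡.trans (*-comm (x * b) (pred n)) (≡.sym (*-assoc (pred n) x b))) ⟩
    g ^ᴳ (pred n * x * b)                                      ∎)

  -- The index of ⟨ x ⟩ in G.
  index : Carrier → ℕ
  index x = gcd (log x) n

  index∣n : ∀ x → index x ∣ n
  index∣n x = gcd[m,n]∣n (log x) n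

  index>0 : ∀ x → 0 < index x
  index>0 x = n≢0⇒n>0 (gcd[m,n]≢0 (log x) n (inj₂ (≢-nonZero⁻¹ n)))

  -- If `y ≈ x ^ᴳ m`, then `m * log x` and `log y` are exponents of the same element, so the divisor
  -- `index x` of `n` passes from the first to the second.
  ∈⇒index∣ : ∀ {x y} → ⟨_⟩ group x y → index x ∣ index y
  ∈⇒index∣ {x} {y} y∈⟨x⟩ with m , _ , y≈x^m ← ∈⇒positivePowerOf 𝔾 y∈⟨x⟩ =
    gcd-greatest (∣-exponent (m * log x) (log y) (index∣n x) g^[m*log[x]]≈g^log[y]
                    (∣n⇒∣m*n m (gcd[m,n]∣m (log x) n)))
                 (index∣n x)
    where
    g^[m*log[x]]≈g^log[y] : g ^ᴳ (m * log x) ≈ g ^ᴳ log y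
    g^[m*log[x]]≈g^log[y] = begin
      g ^ᴳ (m * log x)    ≈⟨ ×-assocˡ g m (log x) ⟨
      (g ^ᴳ log x) ^ᴳ m   ≈⟨ ×-congʳ m (g^log x) ⟨
      x ^ᴳ m              ≈⟨ y≈x^m ⟨
      y                   ≈⟨ g^log y ⟩
      g ^ᴳ log y          ∎

  -- By Bézout `g ^ᴳ index x` is a power of `x`, and `log y` is a multiple of `index x`.
  index∣⇒∈ : ∀ {x y} → index x ∣ index y → ⟨_⟩ group x y
  index∣⇒∈ {x} {y} ix∣iy
    with divides q log[y]≡q*index[x] ← ∣-trans ix∣iy (gcd[m,n]∣m (log y) n)
       | m , g^index≈g^[m*log[x]] ← g^gcd-power (log x) = + (q * m) , (begin
    y                            ≈⟨ g^log y ⟩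
    g ^ᴳ log y                   ≈⟨ ×-congˡ log[y]≡q*index[x] ⟩
    g ^ᴳ (q * index x)           ≈⟨ ×-assocˡ g q (index x) ⟨
    (g ^ᴳ index x) ^ᴳ q          ≈⟨ ×-congʳ q g^index≈g^[m*log[x]] ⟩
    (g ^ᴳ (m * log x)) ^ᴳ q      ≈⟨ ×-congʳ q (×-assocˡ g m (log x)) ⟨
    ((g ^ᴳ log x) ^ᴳ m) ^ᴳ q     ≈⟨ ×-congʳ q (×-congʳ m (g^log x)) ⟨
    (x ^ᴳ m) ^ᴳ q                ≈⟨ ×-assocˡ x q m ⟩
    x ^ᴳ (q * m)                 ∎)

  ∼⇒index≡ : ∀ {x y} → _∼_ group x y → index x ≡ index y
  ∼⇒index≡ (⟨x⟩⊆⟨y⟩ , ⟨y⟩⊆⟨x⟩) =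
    -- `index∣⇒∈ ∣-refl` says that an element lies in the subgroup it generates.
    ∣-antisym (∈⇒index∣ (⟨y⟩⊆⟨x⟩ (index∣⇒∈ ∣-refl)))
              (∈⇒index∣ (⟨x⟩⊆⟨y⟩ (index∣⇒∈ ∣-refl)))

  index≡⇒∼ : ∀ {x y} → index x ≡ index y → _∼_ group x y
  index≡⇒∼ ix≡iy =
      (λ z∈⟨x⟩ → index∣⇒∈ (∣-trans (∣-reflexive (≡.sym ix≡iy)) (∈⇒index∣ z∈⟨x⟩)))
    , (λ z∈⟨y⟩ → index∣⇒∈ (∣-trans (∣-reflexive ix≡iy) (∈⇒index∣ z∈⟨y⟩)))

  -- Both `d` and `log (g ^ᴳ d)` are exponents of `g ^ᴳ d`, so the same divisors of `n` divide them.
  -- This makes `g ^ᴳ d` a representative of the class belonging to `d`.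
  index[g^d]≡d : ∀ {d} → d ∣ n → index (g ^ᴳ d) ≡ d
  index[g^d]≡d {d} d∣n = ∣-antisym
    (∣-exponent (log (g ^ᴳ d)) d (index∣n (g ^ᴳ d)) (sym (g^log (g ^ᴳ d)))
      (gcd[m,n]∣m (log (g ^ᴳ d)) n))
    (gcd-greatest (∣-exponent d (log (g ^ᴳ d)) d∣n (g^log (g ^ᴳ d)) ∣-refl) d∣n)

  positivePowerOf⇒index∣ : ∀ {x y} → PositivePowerOf group x y → index y ∣ index x
  positivePowerOf⇒index∣ (m , _ , x≈y^m) = ∈⇒index∣ (+ m , x≈y^m)

  -- The exponent supplied by `index∣⇒∈` may be 0; finiteness allows a positive one.
  index∣⇒positivePowerOf : ∀ {x y} → index y ∣ index x → PositivePowerOf group x y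
  index∣⇒positivePowerOf iy∣ix = ∈⇒positivePowerOf 𝔾 (index∣⇒∈ iy∣ix)

  reducedPowerGraph≅divisorGraph : reducedPowerGraph 𝔾 ≅ divisorGraph n
  reducedPowerGraph≅divisorGraph = record
    { vertexInverse = record
      { to        = λ x → divisor (index x) (index>0 x) (index∣n x)
      ; from      = λ d → g ^ᴳ value d
      ; to-cong   = ∼⇒index≡
      ; from-cong = λ d≡e → ≈⇒∼ group (×-congˡ d≡e)
      ; inverse   =
          (λ {d} y∼g^d → ≡.trans (∼⇒index≡ y∼g^d) (index[g^d]≡d (Divisor.divides d)))
        , (λ {_} {d} d≡ix → index≡⇒∼ (≡.trans (index[g^d]≡d (Divisor.divides d)) d≡ix))
      }
    ; adj⇔ = λ x y → mk⇔
        (λ (x≁y , _ , p) →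
            x≁y ∘ index≡⇒∼
          -- Passing to indices reverses the order: a power of `y` has an index divisible by that of
          -- `y`, so the two alternatives trade places.
          , Sum.swap (Sum.map positivePowerOf⇒index∣ positivePowerOf⇒index∣ p))
        (λ (ix≢iy , p) →
            ix≢iy ∘ ∼⇒index≡
          -- The underlying edge of the power graph also needs distinct representatives; equal ones
          -- would have equal indices.
          , ix≢iy ∘ ∼⇒index≡ ∘ ≈⇒∼ group
          , Sum.map index∣⇒positivePowerOf index∣⇒positivePowerOf (Sum.swap p))
    }

mainTheorem6 : ∀ {c ℓ : Level} (n : ℕ) .{{_ : NonZero n}} (G : FiniteGroup c ℓ) →
    FiniteGroup.order G ≡ n → IsCyclic (FiniteGroup.group G) →
    reducedPowerGraph G ≅ divisorGraph n
mainTheorem6 _ G ≡.refl cyclic = CyclicGroup.reducedPowerGraph≅divisorGraph G cyclic
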